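{- Let $\psi=(\psi_1,\dots,\psi_k)$ be an insufficient refinement, let $\mathcal{C}=(C_1,\dots,C_k)$ be a sequence of sets of counterstrategies, let $\psi'$ be an assumption and let $c'$ be a counterstrategy. Suppose that: (1) for every $i\in\{1,\dots,k\}$ and every $c\in\bigcup\mathcal{C}$, $c\in C_i$ if and only if $c\not\models\psi_i$; (2) $c'\not\models\psi'$; (3) $c'\models\psi$. Let $(\psi_{new},\mathcal{C}_{new})$ be the output of the procedure MinimalRefinement on input $(\psi,\mathcal{C},\psi',c')$. Then $\psi_{new}$ is minimal with respect to $\bigcup\mathcal{C}_{new}$.
   Context: **Formulae.** Let $\mathcal{V}$ be a set of Boolean variables. LTL formulae over $\mathcal{V}$ are built from variables with $\lnot,\land,\mathbf{X}$ (next), $\mathbf{U}$ (until), and derived operators $\mathbf{F}\phi\equiv \mathit{true}\,\mathbf{U}\,\phi$, $\mathbf{G}\phi\equiv\lnot\mathbf{F}\lnot\phi$, with the usual semantics over infinite sequences of valuations (a valuation is identified with the set of variables that are true). A GR(1) formula has the form $\phi^{\mathcal{E}}\to\phi^{\mathcal{S}}$, where $\phi^{\mathcal{E}}$ (whose conjuncts are called assumptions) and $\phi^{\mathcal{S}}$ (whose conjuncts are called guarantees) are conjunctions of formulae each of which is an initial condition (a Boolean formula over $\mathcal{V}$), an invariant ($\mathbf{G}B$ with $B$ a Boolean combination of elements of $\mathcal{V}\cup\mathbf{X}\mathcal{V}$), or a fairness condition ($\mathbf{G}\mathbf{F}B$ with $B$ a Boolean formula over $\mathcal{V}$). It is realizable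 if there is a controller strategy, choosing the output variables in response to the history and to the environment's current choice of the input variables, that ensures the guarantees whenever the assumptions hold; otherwise it is unrealizable. Fix an unrealizable GR(1) specification $\phi^{\mathcal{E}}\to\phi^{\mathcal{S}}$. A refinement $\psi$ is a (finite) set of assumptions $\{\psi_1,\dots,\psi_k\}$, each an initial condition, an invariant or a fairness condition, also identified with the conjunction $\psi_1\land\dots\land\psi_k$; when listed as a sequence its members are distinct. It is insufficient if $\phi^{\mathcal{E}}\land\psi\to\phi^{\mathcal{S}}$ is unrealizable. **Counterstrategies.** A counterstrategy is a transition system $c=(Q_c,\delta_c,Q_0,\lambda_c)$ with states $Q_c$, transitions $\delta_c\subseteq Q_c\times Q_c$, initial states $Q_0\subseteq Q_c$ and labeling $\lambda_c:Q_c\to 2^{\mathcal{V}\cup\mathcal{M}}$, where $\mathcal{M}$ is a set of auxiliary memory variables not occurring in assumptions or guarantees; it represents an environment strategy forcing violation of a guarantee (all its plays satisfy the assumptions of the specification for which it is computed and violate at least one guarantee). A run is an infinite sequence $q_1q_2\dots$ with $q_1\in Q_0$ and $(q_i,q_{i+1})\in\delta_c$ for all $i$; its play is $\lambda_c(q_1)\lambda_c(q_2)\dots$. For an LTL formula $\phi$, $c\models\phi$ iff all plays of $c$ satisfy $\phi$, and $c\not\models\phi$ otherwise (then $\phi$ is said to eliminate $c$). For a collection $\mathcal{C}=(C_1,\dots,C_k)$ of sets of counterstrategies, $\bigcup\mathcal{C}=\bigcup_{i=1}^k C_i$. **Redundancy and minimality.** Given a set of assumptions $\psi$ and a set of counterstrategies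 $C$, an assumption $\psi_i$ is redundant with respect to $\psi$ and $C$ iff for all $c\in C$, $c\not\models\bigwedge_{\psi_h\in\psi,\,h\neq i}\psi_h$ (the empty conjunction is $\mathit{true}$). The set $\psi$ is minimal with respect to $C$ if none of its assumptions is redundant with respect to $\psi$ and $C$. **Procedure MinimalRefinement**$(\psi,\mathcal{C},\psi',c')$, with $\psi=(\psi_1,\dots,\psi_k)$ and $\mathcal{C}=(C_1,\dots,C_k)$: 1. Set $C':=\{c'\}\cup\{c\in\bigcup\mathcal{C} : c\not\models\psi'\}$. 2. Set $\psi_{new}:=(\psi_1,\dots,\psi_k,\psi')$ and $\mathcal{C}_{new}:=(C_1,\dots,C_k,C')$. 3. For each $c\in\bigcup\mathcal{C}_{new}$, set $c.degree$ to the number of members of the sequence $\mathcal{C}_{new}$ that contain $c$. 4. For $i=1,\dots,k$ in this order: if $c.degree\geq 2$ for all $c\in C_i$, then remove the entry $\psi_i$ from $\psi_{new}$, remove the corresponding entry $C_i$ from $\mathcal{C}_{new}$, and decrease $c.degree$ by $1$ for each $c\in C_i$. 5. Return $(\psi_{new},\mathcal{C}_{new})$. -}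

module Defs where

open import Axiom.ExcludedMiddle using (ExcludedMiddle)
open import Data.Bool.Base using (Bool; true)
open import Data.Fin.Base using (Fin)
open import Data.Fin.Properties using (_≟_)
open import Data.List.Base as List using (List; []; _∷_; _++_)
open import Data.List.Relation.Unary.Any using (Any)
open import Data.Nat.Base using (ℕ; suc; pred; _≤_; _<_)
open import Data.Product.Base using (Σ-syntax; ∃-syntax; _×_; _,_; proj₁; proj₂)
open import Data.Sum.Base using (_⊎_; inj₁; inj₂; [_,_]′)
open import Data.Unit.Base using (⊤)
open import Data.Vec.Base using (Vec; []; _∷_; _∷ʳ_; lookup)
open import Function.Base using (_∘_)
open import Level using (0ℓ)
open import Relation.Binary.PropositionalEquality using (_≡_; refl)
open import Relation.Nullary using (¬_; ¬?; yes; no)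
open import Relation.Nullary.Negation using (contradiction)
open import Relation.Unary using (Pred; _∈_; _∉_; _∩_; _∪_; ｛_｝; ⋃)

-- The Boolean variables are the disjoint union of the inputs (chosen by the
-- environment) and the outputs (chosen by the controller); the memory variables
-- only occur in the labels of counterstrategies.
module GR1 (Input Output Memory : Set) where

  Var : Set
  Var = Input ⊎ Output

  Valuation : Set → Set
  Valuation A = A → Bool

  infixr 7 _∧′_
  infixr 6 _U_
  infix  8 ¬′_ X_ F_ G_

  data LTL : Set where
    var  : Var → LTL
    ⊤′   : LTL
    ¬′_  : LTL → LTL
    _∧′_ : LTL → LTL → LTL
    X_   : LTL → LTL
    _U_  : LTL → LTL → LTL

  F_ G_ : LTL → LTL
  F φ = ⊤′ U φ
  G φ = ¬′ F (¬′ φ)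

  infixr 5 _⇒_

  _⇒_ : LTL → LTL → LTL
  φ ⇒ χ = ¬′ (φ ∧′ ¬′ χ)

  ⋀ : List LTL → LTL
  ⋀ = List.foldr _∧′_ ⊤′

  Sequence : Set → Set
  Sequence A = ℕ → Valuation A

  infix 4 _at_⊨_ _⊨_

  _at_⊨_ : Sequence Var → ℕ → LTL → Set
  σ at i ⊨ var v  = σ i v ≡ true
  σ at i ⊨ ⊤′     = ⊤
  σ at i ⊨ ¬′ φ   = ¬ (σ at i ⊨ φ)
  σ at i ⊨ φ ∧′ χ = (σ at i ⊨ φ) × (σ at i ⊨ χ)
  σ at i ⊨ X φ    = σ at suc i ⊨ φ
  σ at i ⊨ φ U χ  =
    ∃[ j ] i ≤ j × (σ at j ⊨ χ) × (∀ k → i ≤ k → k < j → σ at k ⊨ φ)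

  _⊨_ : Sequence Var → LTL → Set
  σ ⊨ φ = σ at 0 ⊨ φ

  data Boolean (A : Set) : Set where
    atom : A → Boolean A
    ⊤ᵇ   : Boolean A
    ¬ᵇ_  : Boolean A → Boolean A
    _∧ᵇ_ : Boolean A → Boolean A → Boolean A

  fromBoolean : {A : Set} → (A → LTL) → Boolean A → LTL
  fromBoolean f (atom a) = f a
  fromBoolean f ⊤ᵇ       = ⊤′
  fromBoolean f (¬ᵇ b)   = ¬′ fromBoolean f b
  fromBoolean f (b ∧ᵇ c) = fromBoolean f b ∧′ fromBoolean f c

  -- In an invariant, inj₁ v stands for v and inj₂ v for X v.
  data Conjunct : Set where
    initial   : Boolean Var → Conjunct
    invariant : Boolean (Var ⊎ Var) → Conjunct
    fairness  : Boolean Var → Conjunct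

  formula : Conjunct → LTL
  formula (initial b)   = fromBoolean var b
  formula (invariant b) = G fromBoolean [ var , (λ v → X var v) ]′ b
  formula (fairness b)  = G F fromBoolean var b

  conjunction : List Conjunct → LTL
  conjunction = ⋀ ∘ List.map formula

  record Specification : Set where
    constructor _⟶_
    field
      assumptions guarantees : List Conjunct

  open Specification public

  specFormula : Specification → LTL
  specFormula S = conjunction (assumptions S) ⇒ conjunction (guarantees S)

  infixl 6 _assuming_

  _assuming_ : Specification → List Conjunct → Specification
  S assuming ψ = (assumptions S ++ ψ) ⟶ guarantees S

  ControllerStrategy : Set
  ControllerStrategy = List (Valuation Var) → Valuation Input → Valuation Output

  Outcome : ControllerStrategy → Pred (Sequence Var) 0ℓ
  Outcome f σ = ∀ n y → σ n (inj₂ y) ≡ f (List.applyUpTo σ n) (σ n ∘ inj₁) y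

  Realizable : Specification → Set
  Realizable S =
    Σ[ f ∈ ControllerStrategy ] (∀ σ → σ ∈ Outcome f → σ ⊨ specFormula S)

  Unrealizable : Specification → Set
  Unrealizable S = ¬ Realizable S

  Insufficient : Specification → List Conjunct → Set
  Insufficient S ψ = Unrealizable (S assuming ψ)

  record TransitionSystem : Set₁ where
    field
      State   : Set
      _↝_     : State → State → Set
      Initial : Pred State 0ℓ
      label   : State → Valuation (Var ⊎ Memory)

    Run : Pred (ℕ → State) 0ℓ
    Run q = q 0 ∈ Initial × (∀ i → q i ↝ q (suc i))

    play : (ℕ → State) → Sequence (Var ⊎ Memory)
    play q = label ∘ q

  open TransitionSystem public using (Run; play)

  -- Formulae do not mention memory variables, so they are evaluated on the
  -- projection of a play to Var.
  visible : Sequence (Var ⊎ Memory) → Sequence Var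
  visible π i = π i ∘ inj₁

  infix 4 _⊩_ _⊮_

  _⊩_ _⊮_ : TransitionSystem → LTL → Set
  c ⊩ φ = ∀ q → q ∈ Run c → visible (play c q) ⊨ φ
  c ⊮ φ = ¬ (c ⊩ φ)

  EnvironmentStrategy : Set
  EnvironmentStrategy = List (Valuation Var) → Valuation Input

  EnvironmentOutcome : EnvironmentStrategy → Pred (Sequence Var) 0ℓ
  EnvironmentOutcome g σ = ∀ n x → σ n (inj₁ x) ≡ g (List.applyUpTo σ n) x

  Defeats : Specification → Pred (Sequence Var) 0ℓ
  Defeats S σ = (σ ⊨ conjunction (assumptions S)) ×
                Any (λ γ → ¬ (σ ⊨ formula γ)) (guarantees S)

  Forces : Specification → Pred EnvironmentStrategy 0ℓ
  Forces S g = ∀ σ → σ ∈ EnvironmentOutcome g → σ ∈ Defeats S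

  -- In the search for a refinement of S, counterstrategies are computed for S
  -- strengthened by some additional assumptions χ.  A transition system need
  -- not contain every outcome of the strategy it represents: controller moves
  -- that already violate a guarantee may be left out.
  IsCounterstrategy : Specification → Pred TransitionSystem 0ℓ
  IsCounterstrategy S c =
    Σ[ χ ∈ List Conjunct ] Σ[ g ∈ EnvironmentStrategy ]
      Forces (S assuming χ) g ×
      (∀ q → q ∈ Run c → visible (play c q) ∈ EnvironmentOutcome g)

  SystemSet : Set₂
  SystemSet = Pred TransitionSystem (Level.suc 0ℓ)

  ⋃ᵛ : ∀ {k} → Vec SystemSet k → SystemSet
  ⋃ᵛ {k} 𝒞 = ⋃[ i ∶ Fin k ] lookup 𝒞 i

  others : ∀ {k} → Vec Conjunct k → Fin k → List Conjunct
  others {k} ψ i = List.map (lookup ψ) (List.filter (λ h → ¬? (h ≟ i)) (List.allFin k))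

  Redundant : ∀ {k} → Vec Conjunct k → SystemSet → Fin k → Set₁
  Redundant ψ C i = ∀ c → c ∈ C → c ⊮ conjunction (others ψ i)

  Minimal : ∀ {k} → Vec Conjunct k → SystemSet → Set₁
  Minimal ψ C = ∀ i → ¬ Redundant ψ C i

  -- Membership in the sets is not decidable, so counting, and hence the
  -- procedure itself, is given by the graph of its input-output relation.
  -- Its totality is classical: see minimalRefinement-total.
  data Count (c : TransitionSystem) : ∀ {k} → Vec SystemSet k → ℕ → Set₂ where
    []   : Count c [] 0
    hit  : ∀ {k n C} {𝒞 : Vec SystemSet k} →
           c ∈ C → Count c 𝒞 n → Count c (C ∷ 𝒞) (suc n)
    miss : ∀ {k n C} {𝒞 : Vec SystemSet k} →
           c ∉ C → Count c 𝒞 n → Count c (C ∷ 𝒞) n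

  Degree : Set₁
  Degree = TransitionSystem → ℕ

  -- Loop d ψ 𝒞 ψ₁ 𝒞₁: with current degrees d, iterating over the entries
  -- ψ and 𝒞 leaves exactly the entries ψ₁ and 𝒞₁.
  data Loop : ∀ {k m} → Degree → Vec Conjunct k → Vec SystemSet k →
              Vec Conjunct m → Vec SystemSet m → Set₂ where
    done   : ∀ {d} → Loop d [] [] [] []
    remove : ∀ {k m d d′ a C} {ψ : Vec Conjunct k} {𝒞} {ψ₁ : Vec Conjunct m} {𝒞₁} →
             (∀ c → c ∈ C → 2 ≤ d c) →
             (∀ c → c ∈ C → d′ c ≡ pred (d c)) →
             (∀ c → c ∉ C → d′ c ≡ d c) →
             Loop d′ ψ 𝒞 ψ₁ 𝒞₁ →
             Loop d (a ∷ ψ) (C ∷ 𝒞) ψ₁ 𝒞₁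
    keep   : ∀ {k m d a C} {ψ : Vec Conjunct k} {𝒞} {ψ₁ : Vec Conjunct m} {𝒞₁} →
             ¬ (∀ c → c ∈ C → 2 ≤ d c) →
             Loop d ψ 𝒞 ψ₁ 𝒞₁ →
             Loop d (a ∷ ψ) (C ∷ 𝒞) (a ∷ ψ₁) (C ∷ 𝒞₁)

  newSet : ∀ {k} → Vec SystemSet k → Conjunct → TransitionSystem → SystemSet
  newSet 𝒞 ψ′ c′ = ｛ c′ ｝ ∪ (⋃ᵛ 𝒞 ∩ (λ c → c ⊮ formula ψ′))

  data MinimalRefinement {k} (ψ : Vec Conjunct k) (𝒞 : Vec SystemSet k)
       (ψ′ : Conjunct) (c′ : TransitionSystem) :
       ∀ {n} → Vec Conjunct n → Vec SystemSet n → Set₂ where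
    output : ∀ {m} {ψ₁ : Vec Conjunct m} {𝒞₁} (d : Degree) →
             let C′ = newSet 𝒞 ψ′ c′ in
             (∀ c → c ∈ ⋃ᵛ (𝒞 ∷ʳ C′) → Count c (𝒞 ∷ʳ C′) (d c)) →
             Loop d ψ 𝒞 ψ₁ 𝒞₁ →
             MinimalRefinement ψ 𝒞 ψ′ c′ (ψ₁ ∷ʳ ψ′) (𝒞₁ ∷ʳ C′)

  module _ (em : ExcludedMiddle (Level.suc 0ℓ)) where

    private
      count : ∀ {k} (𝒞 : Vec SystemSet k) c → ∃[ n ] Count c 𝒞 n
      count []      c = 0 , []
      count (C ∷ 𝒞) c with em {c ∈ C} | count 𝒞 c
      ... | yes c∈C | n , p = suc n , hit c∈C p
      ... | no  c∉C | n , p = n , miss c∉C p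

      decrement : SystemSet → Degree → Degree
      decrement C d c with em {c ∈ C}
      ... | yes _ = pred (d c)
      ... | no  _ = d c

      decrement-∈ : ∀ C d c → c ∈ C → decrement C d c ≡ pred (d c)
      decrement-∈ C d c c∈C with em {c ∈ C}
      ... | yes _   = refl
      ... | no  c∉C = contradiction c∈C c∉C

      decrement-∉ : ∀ C d c → c ∉ C → decrement C d c ≡ d c
      decrement-∉ C d c c∉C with em {c ∈ C}
      ... | yes c∈C = contradiction c∈C c∉C
      ... | no  _   = refl

      loop-total : ∀ {k} d (ψ : Vec Conjunct k) 𝒞 →
                   ∃[ m ] Σ[ ψ₁ ∈ Vec Conjunct m ] ∃[ 𝒞₁ ] Loop d ψ 𝒞 ψ₁ 𝒞₁
      loop-total d []      []      = 0 , [] , [] , done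
      loop-total d (a ∷ ψ) (C ∷ 𝒞) with em {∀ c → c ∈ C → 2 ≤ d c}
      ... | yes p = let m , ψ₁ , 𝒞₁ , l = loop-total (decrement C d) ψ 𝒞 in
                    m , ψ₁ , 𝒞₁ , remove p (decrement-∈ C d) (decrement-∉ C d) l
      ... | no ¬p = let m , ψ₁ , 𝒞₁ , l = loop-total d ψ 𝒞 in
                    suc m , a ∷ ψ₁ , C ∷ 𝒞₁ , keep ¬p l

    minimalRefinement-total :
      ∀ {k} (ψ : Vec Conjunct k) 𝒞 ψ′ c′ →
      ∃[ n ] Σ[ ψₙ ∈ Vec Conjunct n ] ∃[ 𝒞ₙ ] MinimalRefinement ψ 𝒞 ψ′ c′ ψₙ 𝒞ₙ
    minimalRefinement-total ψ 𝒞 ψ′ c′ =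
      let d = λ c → proj₁ (count (𝒞 ∷ʳ newSet 𝒞 ψ′ c′) c)
          m , ψ₁ , 𝒞₁ , l = loop-total d ψ 𝒞
      in suc m , _ , _ ,
         output d (λ c _ → proj₂ (count (𝒞 ∷ʳ newSet 𝒞 ψ′ c′) c)) l

{-# OPTIONS --safe #-}

-- An entry survives the loop only if some system c in its set has degree less
-- than two at that moment, so c lies in no other set still present, and hence
-- in no other set of the output.  By hypothesis (1) and the definition of C′, c
-- then satisfies every other assumption of the output.  For ψ′ itself the
-- witness is c′.
module Submission where

open import Defs
open import Data.Nat.Base using (ℕ; zero; suc; pred; _+_; _≤_; z≤n; s≤s)
open import Data.Nat.Properties using (+-suc; m+n≡0⇒m≡0; m+n≡0⇒n≡0)
open import Data.Fin.Base using (Fin; zero; suc; inject₁; fromℕ)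
open import Data.Fin.Properties using (_≟_)
open import Data.Fin.Relation.Unary.Top using (view; ‵fromℕ; ‵inject₁)
open import Data.List.Base using (List; allFin)
open import Data.List.Relation.Unary.All as All using (All; []; _∷_)
open import Data.List.Relation.Unary.All.Properties using (all-filter; map⁺)
open import Data.Product.Base using (∃-syntax; _×_; _,_; proj₁; proj₂)
open import Data.Sum.Base using (inj₁; inj₂; [_,_]′)
open import Data.Unit.Base using (tt)
open import Data.Vec.Base using (Vec; []; _∷_; _∷ʳ_; lookup; toList)
open import Data.Vec.Relation.Unary.Unique.Propositional using (Unique)
open import Function.Base using (_∘_)
open import Function.Bundles using (_⇔_; Equivalence)
open import Relation.Binary.PropositionalEquality
  using (_≡_; _≢_; refl; sym; cong; subst)
open import Relation.Nullary using (¬_; ¬?; contradiction)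
open import Relation.Unary using (_∈_; _∉_; _⊆_; _∪_)

private
  lookup-∷ʳ-inject₁ : ∀ {a} {A : Set a} {n} (xs : Vec A n) x i →
                      lookup (xs ∷ʳ x) (inject₁ i) ≡ lookup xs i
  lookup-∷ʳ-inject₁ (y ∷ xs) x zero    = refl
  lookup-∷ʳ-inject₁ (y ∷ xs) x (suc i) = lookup-∷ʳ-inject₁ xs x i

  lookup-∷ʳ-fromℕ : ∀ {a} {A : Set a} {n} (xs : Vec A n) x →
                    lookup (xs ∷ʳ x) (fromℕ n) ≡ x
  lookup-∷ʳ-fromℕ []       x = refl
  lookup-∷ʳ-fromℕ (y ∷ xs) x = lookup-∷ʳ-fromℕ xs x

module _ {Input Output Memory : Set} where
  open GR1 Input Output Memory

  -- Hypothesis (1) and the definition of `C′` speak of violation, so satisfaction is reached only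
  -- as `¬ (c ⊮ _)`; this double negation passes through finite conjunctions.
  ⊩-conjunction⁺ : ∀ c {as : List Conjunct} →
                   All (λ a → ¬ (c ⊮ formula a)) as → ¬ (c ⊮ conjunction as)
  ⊩-conjunction⁺ c []       c⊮  = c⊮ (λ _ _ → tt)
  ⊩-conjunction⁺ c (p ∷ ps) c⊮∧ =
    p λ c⊩a → ⊩-conjunction⁺ c ps λ c⊩as →
    c⊮∧ λ q r → c⊩a q r , c⊩as q r

  ⊩-conjunction⁻ : ∀ c {k} (ψ : Vec Conjunct k) → c ⊩ conjunction (toList ψ) →
                   ∀ i → c ⊩ formula (lookup ψ i)
  ⊩-conjunction⁻ c (a ∷ ψ) c⊩ zero    q r = proj₁ (c⊩ q r)
  ⊩-conjunction⁻ c (a ∷ ψ) c⊩ (suc i)     = ⊩-conjunction⁻ c ψ (λ q r → proj₂ (c⊩ q r)) i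

  ⊩-others : ∀ c {k} (ψ : Vec Conjunct k) i →
             (∀ h → h ≢ i → ¬ (c ⊮ formula (lookup ψ h))) →
             ¬ (c ⊮ conjunction (others ψ i))
  ⊩-others c {k} ψ i p =
    ⊩-conjunction⁺ c (map⁺ (All.map (p _) (all-filter (λ h → ¬? (h ≟ i)) (allFin k))))

  count≡0⇒∉ : ∀ c {k} {𝒞 : Vec SystemSet k} {n} → Count c 𝒞 n → n ≡ 0 →
              ∀ i → c ∉ lookup 𝒞 i
  count≡0⇒∉ c (miss c∉C _) _    zero    = c∉C
  count≡0⇒∉ c (miss _ p)   n≡0  (suc i) = count≡0⇒∉ c p n≡0 i

  -- E is the union of the sets that stay for good (C′ and those already kept)
  -- and 𝒞 the sets still to be visited; membership being undecidable, the
  -- multiplicity of c in E enters only through its vanishing.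
  Tally : TransitionSystem → SystemSet → ∀ {k} → Vec SystemSet k → ℕ → Set₂
  Tally c E 𝒞 n = ∃[ a ] ∃[ b ] Count c 𝒞 a × n ≡ a + b × (b ≡ 0 → c ∉ E)

  count⇒tally : ∀ c {C k} (𝒞 : Vec SystemSet k) {n} →
                Count c (𝒞 ∷ʳ C) n → Tally c C 𝒞 n
  count⇒tally c []      (hit _ [])    = 0 , 1 , [] , refl , λ ()
  count⇒tally c []      (miss c∉C []) = 0 , 0 , [] , refl , λ _ → c∉C
  count⇒tally c (_ ∷ 𝒞) (hit c∈ p) with count⇒tally c 𝒞 p
  ... | a , b , q , refl , z = suc a , b , hit c∈ q , refl , z
  count⇒tally c (_ ∷ 𝒞) (miss c∉ p) with count⇒tally c 𝒞 p
  ... | a , b , q , refl , z = a , b , miss c∉ q , refl , z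

  tally-remove : ∀ c E {C k} {𝒞 : Vec SystemSet k} {n n′} →
                 (c ∈ C → n′ ≡ pred n) → (c ∉ C → n′ ≡ n) →
                 Tally c E (C ∷ 𝒞) n → Tally c E 𝒞 n′
  tally-remove _ _ dec _ (_ , b , hit c∈ p , refl , z)   = _ , b , p , dec c∈ , z
  tally-remove _ _ _ same (_ , b , miss c∉ p , refl , z) = _ , b , p , same c∉ , z

  -- The degree stays the same: an occurrence of `c` in `C` moves from the summand `a` to `b`, which
  -- is then positive, so the vanishing clause becomes vacuous.
  tally-keep : ∀ c E {C k} {𝒞 : Vec SystemSet k} {n} →
               Tally c E (C ∷ 𝒞) n → Tally c (E ∪ C) 𝒞 n
  tally-keep _ _ (suc a , b , hit _ p , refl , _) =
    a , suc b , p , sym (+-suc a b) , λ ()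
  tally-keep _ _ (a , b , miss c∉ p , refl , z)   =
    a , b , p , refl , λ b≡0 → [ z b≡0 , c∉ ]′

  -- Stated with the negation so that no case distinction on membership is needed.
  tally-≥2 : ∀ c E {C k} {𝒞 : Vec SystemSet k} {n} → Tally c E (C ∷ 𝒞) n → c ∈ C →
             ¬ (c ∉ E × (∀ i → c ∉ lookup 𝒞 i)) → 2 ≤ n
  tally-≥2 _ _ (_ , _ , miss c∉ _ , _) c∈ _ = contradiction c∈ c∉
  tally-≥2 c _ (suc a , b , hit _ p , refl , z) _ ¬alone with a + b in a+b≡
  ... | suc _ = s≤s (s≤s z≤n)
  ... | zero  = contradiction
    (z (m+n≡0⇒n≡0 a a+b≡) , count≡0⇒∉ c p (m+n≡0⇒m≡0 a a+b≡)) ¬alone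

  -- Carries hypotheses on the input over to the survivors; one `j` serves both vectors because the
  -- loop keeps or drops an assumption and its set together.
  loop-origin : ∀ {k m d} {ψ : Vec Conjunct k} {𝒞} {ψ₁ : Vec Conjunct m} {𝒞₁} →
                Loop d ψ 𝒞 ψ₁ 𝒞₁ → ∀ i →
                ∃[ j ] lookup ψ₁ i ≡ lookup ψ j × lookup 𝒞₁ i ≡ lookup 𝒞 j
  loop-origin (remove _ _ _ l) i = let j , p = loop-origin l i in suc j , p
  loop-origin (keep _ _) zero    = zero , refl , refl
  loop-origin (keep _ l) (suc i) = let j , p = loop-origin l i in suc j , p

  Isolated : SystemSet → ∀ {m} → Vec SystemSet m → Fin m → SystemSet
  Isolated E 𝒞 i c = c ∈ lookup 𝒞 i × c ∉ E × (∀ h → h ≢ i → c ∉ lookup 𝒞 h)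

  -- Existence is doubly negated, as `keep` supplies only a negated universal. `D` holds systems
  -- whose degree is a true count; `E` varies in the induction to absorb kept sets.
  loop-isolated : ∀ {k m d} {ψ : Vec Conjunct k} {𝒞} {ψ₁ : Vec Conjunct m} {𝒞₁} →
                  Loop d ψ 𝒞 ψ₁ 𝒞₁ → (D E : SystemSet) → (∀ c → c ∈ ⋃ᵛ 𝒞 → c ∈ D) →
                  (∀ c → c ∈ D → Tally c E 𝒞 (d c)) →
                  ∀ i → ¬ (∀ c → c ∉ Isolated E 𝒞₁ i)
  loop-isolated (remove _ dec same l) D E 𝒞⊆D t i =
    loop-isolated l D E (λ c (j , c∈) → 𝒞⊆D c (suc j , c∈))
      (λ c c∈D → tally-remove c E (dec c) (same c) (t c c∈D)) i
  loop-isolated (keep ¬2≤ l) D E 𝒞⊆D t zero none =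
    -- Without an isolated system every member of `C` would have degree at least two. Avoiding all
    -- of `𝒞` suffices, since the survivors are among its entries.
    ¬2≤ λ c c∈C → tally-≥2 c E (t c (𝒞⊆D c (zero , c∈C))) c∈C λ (c∉E , c∉𝒞) →
      none c (c∈C , c∉E , λ where
        zero    0≢0 _  → 0≢0 refl
        (suc h) _   c∈ → let j , _ , eq = loop-origin l h in
                         c∉𝒞 j (subst (c ∈_) eq c∈))
  loop-isolated (keep {C = C} _ l) D E 𝒞⊆D t (suc i) none =
    -- With `C` moved into `E`, the system found in the tail also avoids the kept head.
    loop-isolated l D (E ∪ C) (λ c (j , c∈) → 𝒞⊆D c (suc j , c∈))
      (λ c c∈D → tally-keep c E (t c c∈D)) i
      λ c (c∈ , c∉E∪C , c∉) → none c (c∈ , c∉E∪C ∘ inj₁ , λ where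
        zero    _   → c∉E∪C ∘ inj₂
        (suc h) h≢i → c∉ h (h≢i ∘ cong suc))

  ∈-⋃-∷ʳ⁺ : ∀ {k} (𝒞 : Vec SystemSet k) {C} c → c ∈ ⋃ᵛ 𝒞 → c ∈ ⋃ᵛ (𝒞 ∷ʳ C)
  ∈-⋃-∷ʳ⁺ 𝒞 {C} c (i , c∈) =
    inject₁ i , subst (c ∈_) (sym (lookup-∷ʳ-inject₁ 𝒞 C i)) c∈

proposition3 : (Input Output Memory : Set) → let open GR1 Input Output Memory in
    (S : Specification) → Unrealizable S →
    (k : ℕ) (ψ : Vec Conjunct k) → Unique ψ → Insufficient S (toList ψ) →
    (𝒞 : Vec SystemSet k) → ⋃ᵛ 𝒞 ⊆ IsCounterstrategy S →
    (ψ′ : Conjunct) (c′ : TransitionSystem) → c′ ∈ IsCounterstrategy S →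
    ((i : Fin k) (c : TransitionSystem) → c ∈ ⋃ᵛ 𝒞 → (c ∈ lookup 𝒞 i) ⇔ (c ⊮ formula (lookup ψ i))) →
    c′ ⊮ formula ψ′ →
    c′ ⊩ conjunction (toList ψ) →
    (n : ℕ) (ψₙ : Vec Conjunct n) (𝒞ₙ : Vec SystemSet n) →
    MinimalRefinement ψ 𝒞 ψ′ c′ ψₙ 𝒞ₙ →
    Minimal ψₙ (⋃ᵛ 𝒞ₙ)
proposition3 Input Output Memory _ _ k ψ _ _ 𝒞 _ ψ′ c′ _ rejects _ c′⊩ψ _ _ _
  (GR1.output {m} {ψ₁} {𝒞₁} d counts l) i redundant with view i
... | ‵fromℕ = ⊩-others c′ (ψ₁ ∷ʳ ψ′) (fromℕ m) satisfied (redundant c′ c′∈)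
  where
  open GR1 Input Output Memory

  c′∈ : c′ ∈ ⋃ᵛ (𝒞₁ ∷ʳ newSet 𝒞 ψ′ c′)
  c′∈ = fromℕ m , subst (c′ ∈_) (sym (lookup-∷ʳ-fromℕ 𝒞₁ _)) (inj₁ refl)

  satisfied : ∀ h → h ≢ fromℕ m → ¬ (c′ ⊮ formula (lookup (ψ₁ ∷ʳ ψ′) h))
  satisfied h h≢ with view h
  ... | ‵fromℕ = contradiction refl h≢
  ... | ‵inject₁ h′ rewrite lookup-∷ʳ-inject₁ ψ₁ ψ′ h′ =
    let j , ψ≡ , _ = loop-origin l h′ in
    contradiction (subst (λ a → c′ ⊩ formula a) (sym ψ≡) (⊩-conjunction⁻ c′ ψ c′⊩ψ j))
... | ‵inject₁ i′ =
  -- `E` starts as `C′`, which the loop never visits; `D` is the union on which the initial degrees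
  -- are specified.
  loop-isolated l (⋃ᵛ (𝒞 ∷ʳ C′)) C′ (∈-⋃-∷ʳ⁺ 𝒞)
    (λ c → count⇒tally c 𝒞 ∘ counts c) i′
    λ c iso → ⊩-others c (ψ₁ ∷ʳ ψ′) (inject₁ i′) (satisfied c iso)
                (redundant c (∈-⋃-∷ʳ⁺ 𝒞₁ c (i′ , proj₁ iso)))
  where
  open GR1 Input Output Memory

  C′ : SystemSet
  C′ = newSet 𝒞 ψ′ c′

  satisfied : ∀ c → c ∈ Isolated C′ 𝒞₁ i′ →
              ∀ h → h ≢ inject₁ i′ → ¬ (c ⊮ formula (lookup (ψ₁ ∷ʳ ψ′) h))
  satisfied c (c∈ , c∉C′ , c∉) h h≢ c⊮ with view h
  ... | ‵fromℕ rewrite lookup-∷ʳ-fromℕ ψ₁ ψ′ =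
    -- `c` lies in a set of `𝒞`, so violating `ψ′` would put it into `C′`.
    let j , _ , 𝒞≡ = loop-origin l i′ in
    c∉C′ (inj₂ ((j , subst (c ∈_) 𝒞≡ c∈) , c⊮))
  ... | ‵inject₁ h′ rewrite lookup-∷ʳ-inject₁ ψ₁ ψ′ h′ =
    -- `c` lies in the original of entry `i′`, so (1) applies to it: at `j′`, violation puts `c`
    -- into the set surviving as entry `h′`, which isolation forbids.
    let j , _  , 𝒞i≡ = loop-origin l i′
        j′ , ψ≡ , 𝒞≡ = loop-origin l h′
        c∈𝒞j′ = Equivalence.from (rejects j′ c (j , subst (c ∈_) 𝒞i≡ c∈))
                  (subst (λ a → c ⊮ formula a) ψ≡ c⊮)
    in c∉ h′ (h≢ ∘ cong inject₁) (subst (c ∈_) (sym 𝒞≡) c∈𝒞j′)
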